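{- For coherence spaces $A,B$ and a linear morphism $\ell:A\to B$ (identified with its trace $\ell\subset|A|\times|B|$), let $$\mathrm{flag}\,\ell=\{(f,g)\in|\mathrm{flag}\,A|\times|\mathrm{flag}\,B| \mid \forall w\in 2^{\omega}\ (f(w),g(w))\in\ell\}.$$ Then $\mathrm{flag}\,\ell$ is the trace of a linear morphism $\mathrm{flag}\,A\to\mathrm{flag}\,B$, and the assignments $A\mapsto\mathrm{flag}\,A$, $\ell\mapsto\mathrm{flag}\,\ell$ define an endofunctor of the category $\mathbf{Coh}$ of coherence spaces and linear morphisms.
   Context: A coherence space $A$ is a set $|A|$ (its web, possibly infinite, whose elements are called tokens) endowed with a reflexive and symmetric binary relation on $|A|$, called coherence and written $\alpha\sim\alpha'\,[A]$. Strict coherence $\alpha\frown\alpha'\,[A]$ means $\alpha\sim\alpha'\,[A]$ and $\alpha\neq\alpha'$. A clique of $A$ is a set of pairwise coherent tokens. Linear morphisms from $A$ to $B$ are maps $F$ from cliques of $A$ to cliques of $B$ that are monotone for inclusion, commute with unions of families of pairwise compatible cliques (two cliques being compatible when their union is a clique), and satisfy $F(x\cap x')=F(x)\cap F(x')$ whenever $x\cup x'$ is a clique. They are in one-to-one correspondence with their traces $\{(\alpha,\beta)\mid \beta\in F(\{\alpha\})\}\subset|A|\times|B|$, which are exactly the cliques of the coherence space $A\multimap B$ with web $|A|\times|B|$ in which $(\alpha,\beta)\sim(\alpha',\beta')$ iff: ($\alpha\sim\alpha'\,[A]$ implies $\beta\sim\beta'\,[B]$) and ($\alpha\frown\alpha'\,[A]$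 implies $\beta\frown\beta'\,[B]$). Composition of linear morphisms corresponds to relational composition of traces, and the identity has trace $\{(\alpha,\alpha)\mid\alpha\in|A|\}$. $\mathbf{Coh}$ is the category of coherence spaces and linear morphisms. Let $2^{\omega}$ be the set of infinite words on $\{0,1\}$, with the product topology (Cantor space) and the lexicographic total order: $w_1<w_2$ iff there are a finite word $m$ and infinite words $w_1',w_2'$ with $w_1=m0w_1'$ and $w_2=m1w_2'$. For a coherence space $A$, the coherence space $\mathrm{flag}\,A$ is defined as follows. Its web is the set of continuous functions from $2^\omega$ to $|A|$, where $|A|$ has the discrete topology. Two functions $f,g$ in this web are strictly coherent, $f\frown g\,[\mathrm{flag}\,A]$, iff there exists $w\in 2^\omega$ such that $f(w)\frown g(w)\,[A]$ and $f(w')=g(w')$ for all $w'<w$. -}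

module Defs where

open import Data.Bool.Base using (Bool; true; false)
open import Data.List.Base using (List; foldr)
open import Data.Nat.Base using (ℕ; zero; suc) renaming (_<_ to _<ℕ_)
open import Data.Product.Base using (Σ-syntax; ∃-syntax; _×_; _,_; proj₁; proj₂)
open import Data.Sum.Base using (_⊎_; inj₁; inj₂)
open import Function.Base using (_∘_; id)
open import Function.Bundles using (_⇔_; mk⇔)
open import Level using (Level; _⊔_) renaming (suc to lsuc)
open import Relation.Binary.Bundles using (Setoid)
open import Relation.Binary.Core using (Rel; REL)
open import Relation.Binary.Definitions using (Reflexive; Symmetric; _Respects_; _Respects₂_)
open import Relation.Binary.PropositionalEquality.Core using (_≡_; _≗_)
open import Relation.Binary.Structures using (IsEquivalence)
open import Relation.Nullary.Negation.Core using (¬_; contradiction)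
open import Relation.Unary using (Pred; _∈_; _⊆_; _≐_; _∪_; _∩_; ⋃)

record Category (o h e : Level) : Set (lsuc (o ⊔ h ⊔ e)) where
  infix  4 _≈_ _⇒_
  infixr 9 _∙_
  field
    Obj       : Set o
    _⇒_       : Obj → Obj → Set h
    _≈_       : ∀ {A B} → Rel (A ⇒ B) e
    identity  : ∀ {A} → A ⇒ A
    _∙_       : ∀ {A B C} → B ⇒ C → A ⇒ B → A ⇒ C
    ≈-equiv   : ∀ {A B} → IsEquivalence (_≈_ {A} {B})
    identityˡ : ∀ {A B} (f : A ⇒ B) → identity ∙ f ≈ f
    identityʳ : ∀ {A B} (f : A ⇒ B) → f ∙ identity ≈ f
    assoc     : ∀ {A B C D} (h : C ⇒ D) (g : B ⇒ C) (f : A ⇒ B) →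
                (h ∙ g) ∙ f ≈ h ∙ (g ∙ f)
    ∙-cong    : ∀ {A B C} {g g′ : B ⇒ C} {f f′ : A ⇒ B} →
                g ≈ g′ → f ≈ f′ → g ∙ f ≈ g′ ∙ f′

record IsFunctor {o h e o′ h′ e′ : Level}
                 (C : Category o h e) (D : Category o′ h′ e′)
                 (F₀ : Category.Obj C → Category.Obj D)
                 (F₁ : ∀ {A B} → Category._⇒_ C A B → Category._⇒_ D (F₀ A) (F₀ B))
                 : Set (o ⊔ h ⊔ e ⊔ e′) where
  private
    module C = Category C
    module D = Category D
  field
    F-resp-≈ : ∀ {A B} {f g : A C.⇒ B} → f C.≈ g → F₁ f D.≈ F₁ g
    F-id     : ∀ {A} → F₁ (C.identity {A}) D.≈ D.identity
    F-∘      : ∀ {A B C} (g : B C.⇒ C) (f : A C.⇒ B) →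
               F₁ (g C.∙ f) D.≈ F₁ g D.∙ F₁ f

-- The web is a setoid because tokens of flag A are functions, whose
-- equality is pointwise.
record CoherenceSpace (a : Level) : Set (lsuc a) where
  field
    web : Setoid a a
  open Setoid web public renaming (Carrier to Token)
  infix 4 _∼_ _⌢_
  field
    _∼_      : Rel Token a
    ∼-refl   : Reflexive _∼_
    ∼-sym    : Symmetric _∼_
    ∼-resp-≈ : _∼_ Respects₂ _≈_

  _⌢_ : Rel Token a
  α ⌢ α′ = α ∼ α′ × ¬ α ≈ α′

  IsClique : ∀ {ℓ} → Pred Token ℓ → Set (a ⊔ ℓ)
  IsClique P = ∀ {α α′} → α ∈ P → α′ ∈ P → α ∼ α′

open CoherenceSpace using (Token; IsClique)

private
  variable
    a : Level
    A B C : CoherenceSpace a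

record Clique (A : CoherenceSpace a) : Set (lsuc a) where
  private module A = CoherenceSpace A
  field
    tokens   : Pred A.Token a
    resp     : tokens Respects A._≈_
    coherent : IsClique A tokens

open Clique public using (tokens)

infix 4 _⊑_
_⊑_ : Rel (Clique A) _
x ⊑ y = tokens x ⊆ tokens y

Compatible : Rel (Clique A) _
Compatible {A = A} x y = IsClique A (tokens x ∪ tokens y)

infixr 7 _⊓_
_⊓_ : Clique A → Clique A → Clique A
x ⊓ y = record
  { tokens   = tokens x ∩ tokens y
  ; resp     = λ { e (p , q) → Clique.resp x e p , Clique.resp y e q }
  ; coherent = λ { (p , _) (q , _) → Clique.coherent x p q }
  }

-- Index types of level a suffice to write each clique as the union of
-- the singletons of its elements.
⨆ : {A : CoherenceSpace a} {I : Set a} (x : I → Clique A) →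
    (∀ i j → Compatible (x i) (x j)) → Clique A
⨆ {I = I} x compat = record
  { tokens   = ⋃ I (tokens ∘ x)
  ; resp     = λ { e (i , p) → i , Clique.resp (x i) e p }
  ; coherent = λ { (i , p) (j , q) → compat i j (inj₁ p) (inj₂ q) }
  }

singleton : (A : CoherenceSpace a) → Token A → Clique A
singleton A α = record
  { tokens   = α ≈_
  ; resp     = λ e p → trans p e
  ; coherent = λ p q → proj₁ ∼-resp-≈ q (proj₂ ∼-resp-≈ p ∼-refl)
  }
  where open CoherenceSpace A

record LinearMorphism (A B : CoherenceSpace a) : Set (lsuc a) where
  field
    fun      : Clique A → Clique B
    monotone : ∀ {x y} → x ⊑ y → fun x ⊑ fun y
    ⨆-comm   : ∀ {I : Set a} (x : I → Clique A) (c : ∀ i j → Compatible (x i) (x j)) →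
               tokens (fun (⨆ x c)) ≐ ⋃ I (tokens ∘ fun ∘ x)
    ⊓-comm   : ∀ x y → Compatible x y →
               tokens (fun (x ⊓ y)) ≐ tokens (fun x) ∩ tokens (fun y)

open LinearMorphism public using (fun)

trace : LinearMorphism A B → REL (Token A) (Token B) _
trace {A = A} F α β = β ∈ tokens (fun F (singleton A α))

infix 4 _≋_
_≋_ : Rel (LinearMorphism A B) _
F ≋ G = ∀ x → tokens (fun F x) ≐ tokens (fun G x)

private
  compatible-image : (F : LinearMorphism A B) {x y : Clique A} →
                     Compatible x y → Compatible (fun F x) (fun F y)
  compatible-image {A = A} F {x} {y} c p q =
    Clique.coherent (fun F x∪y) (into p) (into q)
    where
    x∪y : Clique A
    x∪y = record
      { tokens   = tokens x ∪ tokens y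
      ; resp     = λ { e (inj₁ p) → inj₁ (Clique.resp x e p)
                     ; e (inj₂ p) → inj₂ (Clique.resp y e p) }
      ; coherent = c
      }
    into : tokens (fun F x) ∪ tokens (fun F y) ⊆ tokens (fun F x∪y)
    into (inj₁ p) = LinearMorphism.monotone F {x} {x∪y} inj₁ p
    into (inj₂ p) = LinearMorphism.monotone F {y} {x∪y} inj₂ p

idᴸ : LinearMorphism A A
idᴸ = record
  { fun      = id
  ; monotone = id
  ; ⨆-comm   = λ _ _ → id , id
  ; ⊓-comm   = λ _ _ _ → id , id
  }

infixr 9 _∘ᴸ_
_∘ᴸ_ : LinearMorphism B C → LinearMorphism A B → LinearMorphism A C
_∘ᴸ_ {B = B} G F = record
  { fun      = fun G ∘ fun F
  ; monotone = λ {x} {y} x⊑y →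
      G.monotone {fun F x} {fun F y} (F.monotone {x} {y} x⊑y)
  ; ⨆-comm   = λ x c →
      let c′ : ∀ i j → Compatible (fun F (x i)) (fun F (x j))
          c′ i j = compatible-image F {x i} {x j} (c i j)
          l , r   = F.⨆-comm x c
          l′ , r′ = G.⨆-comm (fun F ∘ x) c′
      in l′ ∘ G.monotone {fun F (⨆ x c)} {⨆ (fun F ∘ x) c′} l
       , G.monotone {⨆ (fun F ∘ x) c′} {fun F (⨆ x c)} r ∘ r′
  ; ⊓-comm   = λ x y c →
      let l , r   = F.⊓-comm x y c
          l′ , r′ = G.⊓-comm (fun F x) (fun F y) (compatible-image F {x} {y} c)
      in l′ ∘ G.monotone {fun F (x ⊓ y)} {fun F x ⊓ fun F y} l
       , G.monotone {fun F x ⊓ fun F y} {fun F (x ⊓ y)} r ∘ r′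
  }
  where
  module F = LinearMorphism F
  module G = LinearMorphism G

Coh : (a : Level) → Category (lsuc a) (lsuc a) (lsuc a)
Coh a = record
  { Obj       = CoherenceSpace a
  ; _⇒_       = LinearMorphism
  ; _≈_       = _≋_
  ; identity  = idᴸ
  ; _∙_       = _∘ᴸ_
  ; ≈-equiv   = record
    { refl  = λ _ → id , id
    ; sym   = λ F≋G x → proj₂ (F≋G x) , proj₁ (F≋G x)
    ; trans = λ F≋G G≋H x →
        proj₁ (G≋H x) ∘ proj₁ (F≋G x) , proj₂ (F≋G x) ∘ proj₂ (G≋H x)
    }
  ; identityˡ = λ _ _ → id , id
  ; identityʳ = λ _ _ → id , id
  ; assoc     = λ _ _ _ _ → id , id
  ; ∙-cong    = λ {_} {_} {_} {G} {G′} {F} {F′} G≋G′ F≋F′ x →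
        proj₁ (G≋G′ (fun F′ x))
          ∘ LinearMorphism.monotone G {fun F x} {fun F′ x} (proj₁ (F≋F′ x))
      , LinearMorphism.monotone G {fun F′ x} {fun F x} (proj₂ (F≋F′ x))
          ∘ proj₂ (G≋G′ (fun F′ x))
  }

2^ω : Set
2^ω = ℕ → Bool

infixr 5 _∷ω_ _++ω_
_∷ω_ : Bool → 2^ω → 2^ω
(b ∷ω w) zero    = b
(b ∷ω w) (suc n) = w n

_++ω_ : List Bool → 2^ω → 2^ω
m ++ω w = foldr _∷ω_ w m

infix 4 _<_
_<_ : Rel 2^ω _
w₁ < w₂ = ∃[ m ] ∃[ w₁′ ] ∃[ w₂′ ]
  w₁ ≗ m ++ω (false ∷ω w₁′) × w₂ ≗ m ++ω (true ∷ω w₂′)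

-- The cylinder of words agreeing with w on their first n letters; these
-- cylinders form a neighbourhood basis of w in the product topology.
Cylinder : 2^ω → ℕ → Pred 2^ω _
Cylinder w n w′ = ∀ i → i <ℕ n → w i ≡ w′ i

Open : ∀ {ℓ} → Pred 2^ω ℓ → Set ℓ
Open U = ∀ w → w ∈ U → ∃[ n ] Cylinder w n ⊆ U

-- Continuity into the discrete space |A|, tested on the basis of
-- singletons: testing all subsets would raise the universe level of the
-- web of flag A.  In particular a continuous function identifies
-- pointwise equal words.
Continuous : (A : CoherenceSpace a) → (2^ω → Token A) → Set a
Continuous A f = ∀ α → Open (λ w → f w ≈ α)
  where open CoherenceSpace A

FlagToken : CoherenceSpace a → Set a
FlagToken A = Σ[ f ∈ (2^ω → Token A) ] Continuous A f


flagWeb : CoherenceSpace a → Setoid a a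
flagWeb A = record
  { Carrier       = FlagToken A
  ; _≈_           = λ f g → ∀ w → proj₁ f w ≈ proj₁ g w
  ; isEquivalence = record
    { refl  = λ _ → refl
    ; sym   = λ p w → sym (p w)
    ; trans = λ p q w → trans (p w) (q w)
    }
  }
  where open CoherenceSpace A

FlagStrict : (A : CoherenceSpace a) → Rel (FlagToken A) a
FlagStrict A f g =
  ∃[ w ] (proj₁ f w ⌢ proj₁ g w × (∀ w′ → w′ < w → proj₁ f w′ ≈ proj₁ g w′))
  where open CoherenceSpace A

flag : CoherenceSpace a → CoherenceSpace a
flag A = record
  { web      = flagWeb A
  ; _∼_      = λ f g → F._≈_ f g ⊎ FlagStrict A f g
  ; ∼-refl   = λ {f} → inj₁ (F.refl {f})
  ; ∼-sym    = λ where
      (inj₁ p) → inj₁ (λ w → sym (p w))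
      (inj₂ (w , (c , n) , p)) →
        inj₂ (w , (∼-sym c , n ∘ sym) , λ w′ l → sym (p w′ l))
  ; ∼-resp-≈ =
      (λ where
        e (inj₁ p) → inj₁ (λ w → trans (p w) (e w))
        e (inj₂ (w , (c , n) , p)) →
          inj₂ ( w
               , (proj₁ ∼-resp-≈ (e w) c , λ q → n (trans q (sym (e w))))
               , λ w′ l → trans (p w′ l) (e w′)))
    , (λ where
        e (inj₁ p) → inj₁ (λ w → trans (sym (e w)) (p w))
        e (inj₂ (w , (c , n) , p)) →
          inj₂ ( w
               , (proj₂ ∼-resp-≈ (e w) c , λ q → n (trans (e w) q))
               , λ w′ l → trans (sym (e w′)) (p w′ l)))
  }
  where
  open CoherenceSpace A
  module F = Setoid (flagWeb A)

flag-⌢ : (A : CoherenceSpace a) (f g : FlagToken A) →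
         CoherenceSpace._⌢_ (flag A) f g ⇔ FlagStrict A f g
flag-⌢ A f g = mk⇔
  (λ where
    (inj₁ p , n) → contradiction p n
    (inj₂ s , _) → s)
  (λ where s@(w , (_ , n) , _) → inj₂ s , λ p → n (p w))

flagRel : (A B : CoherenceSpace a) {ℓ : Level} →
          REL (Token A) (Token B) ℓ → REL (Token (flag A)) (Token (flag B)) ℓ
flagRel A B R f g = ∀ w → R (proj₁ f w) (proj₁ g w)

{-# OPTIONS --safe #-}

-- A linear morphism ℓ preserves coherence and is injective on coherent
-- tokens: coherent α, α′ with a common ℓ-successor are equal, since
-- {α} ∩ {α′} is otherwise empty and ℓ(∅) = ∅.  Two continuous functions
-- g ≠ g′ have a lexicographically least point of disagreement, because
-- the set of disagreement is closed.  If (f , g) and (f′ , g′) are in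
-- flag ℓ and f ∼ f′, that point is at most the one witnessing f ⌢ f′,
-- so f and f′, hence g and g′, are coherent there.  For composition, the
-- intermediate token of a pair in the composite trace is unique, so it
-- depends continuously on the word.
module Submission where

open import Axiom.ExcludedMiddle using (ExcludedMiddle)
open import Data.Bool.Base using (Bool; true; false)
open import Data.Empty.Polymorphic using (⊥; ⊥-elim)
open import Data.List.Base using ([]; _∷_)
open import Data.Nat.Base using (zero; suc; s≤s; _⊔_)
open import Data.Nat.Properties using (m<n⇒m<n⊔o; m<n⇒m<o⊔n)
open import Data.Product.Base using (Σ-syntax; ∃; ∃-syntax; _×_; _,_; proj₁; proj₂)
open import Data.Sum.Base using (inj₁; inj₂)
open import Function.Base using (_∘_)
open import Function.Bundles using (_⇔_; mk⇔)
open import Level using (Level)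
open import Relation.Binary.Definitions using (_Respects_)
open import Relation.Binary.PropositionalEquality using (_≡_; _≗_; refl; sym; trans)
open import Relation.Nullary.Decidable using (yes; no; decidable-stable)
open import Relation.Nullary.Negation using (¬_; contradiction)
open import Relation.Unary using (Pred; _∈_; _∉_; ∁; _∪_)
open import Defs

private
  variable
    a : Level

-- Infinite words

tail : 2^ω → 2^ω
tail w = w ∘ suc

∷ω-cong : ∀ {b c v w} → b ≡ c → v ≗ w → b ∷ω v ≗ c ∷ω w
∷ω-cong p q zero    = p
∷ω-cong p q (suc n) = q n

∷ω-η : ∀ {b} w → w zero ≡ b → w ≗ b ∷ω tail w
∷ω-η w p zero    = p
∷ω-η w p (suc n) = refl

∷-< : ∀ {v w} → v zero ≡ w zero → tail v < tail w → v < w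
∷-< {v} p (m , v′ , w′ , q , r) =
  v zero ∷ m , v′ , w′
  , (λ { zero → refl  ; (suc n) → q n })
  , (λ { zero → sym p ; (suc n) → r n })

-- Distinct first letters would give a comparison with empty common prefix. Equal first letters pass
-- incomparability on to the tails, so each further letter follows by recursion.
<-connex : ∀ {v w} → ¬ v < w → ¬ w < v → v ≗ w
<-connex {v} {w} v≮w w≮v zero with v zero in p | w zero in q
... | false | false = refl
... | true  | true  = refl
... | false | true  = contradiction ([] , tail v , tail w , ∷ω-η v p , ∷ω-η w q) v≮w
... | true  | false = contradiction ([] , tail w , tail v , ∷ω-η w q , ∷ω-η v p) w≮v
<-connex {v} {w} v≮w w≮v (suc n) =
  <-connex (v≮w ∘ ∷-< {v} {w} p) (w≮v ∘ ∷-< {w} {v} (sym p)) n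
  where p = <-connex {v} {w} v≮w w≮v zero

-- Least elements of closed sets

module LeastWord (em : ExcludedMiddle a) where

  first : Pred 2^ω a → Bool
  first D with em {∃[ w ] false ∷ω w ∈ D}
  ... | yes _ = false
  ... | no  _ = true

  -- Greedy: each letter is 0 whenever some element of D still allows it.
  least : Pred 2^ω a → 2^ω
  least D zero    = first D
  least D (suc n) = least (D ∘ (first D ∷ω_)) n

  first-false : ∀ D {w} → false ∷ω w ∈ D → first D ≡ false
  first-false D {w} p with em {∃[ w ] false ∷ω w ∈ D}
  ... | yes _ = refl
  ... | no ¬p = contradiction (w , p) ¬p

  first-attained : ∀ D → D Respects _≗_ → ∃ D → ∃[ w ] first D ∷ω w ∈ D
  first-attained D resp (u , p) with em {∃[ w ] false ∷ω w ∈ D}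
  ... | yes q = q
  ... | no ¬q with u zero in eq
  ...   | false = contradiction (tail u , resp (∷ω-η u eq) p) ¬q
  ...   | true  = tail u , resp (∷ω-η u eq) p

  -- By `first-attained`, each greedy choice leaves a nonempty set of continuations, so the descent
  -- can run for any finite number of letters.
  least-approx : ∀ D → D Respects _≗_ → ∃ D → ∀ n →
                 ∃[ u ] (u ∈ D × u ∈ Cylinder (least D) n)
  least-approx D resp (u , p) zero = u , p , λ _ ()
  least-approx D resp p (suc n)
    with u , q , c ← least-approx (D ∘ (first D ∷ω_)) (resp ∘ ∷ω-cong refl)
                       (first-attained D resp p) n
    = first D ∷ω u , q , λ { zero _ → refl ; (suc i) (s≤s l) → c i l }

  -- Induction on the common prefix `m`. At its end a word of the current set starts with 0, which
  -- forces the greedy letter to be 0, while `q` makes it 1.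
  least-minimal : ∀ D → D Respects _≗_ → ∀ m {w w₁ w₂} →
                  w ≗ m ++ω (false ∷ω w₁) → least D ≗ m ++ω (true ∷ω w₂) → w ∉ D
  least-minimal D resp [] p q d
    with () ← trans (sym (q zero)) (first-false D (resp p d))
  least-minimal D resp (b ∷ m) p q d =
    -- `q zero` identifies `b` with the greedy letter, so the tail of `w` lies in the set of
    -- continuations.
    least-minimal (D ∘ (first D ∷ω_)) (resp ∘ ∷ω-cong refl) m (λ _ → refl) (q ∘ suc)
      (resp (λ n → trans (p n) (∷ω-cong (sym (q zero)) (λ _ → refl) n)) d)

  -- If the greedy word lay outside `D`, some cylinder around it would miss `D`, contradicting
  -- `least-approx`.
  closed⇒least : ∀ D → Open (∁ D) → ∃ D →
                 ∃[ v ] (v ∈ D × (∀ w → w < v → w ∉ D))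
  closed⇒least D open∁ p =
    least D
    , decidable-stable em (λ v∉D →
        let n , c       = open∁ (least D) v∉D
            u , u∈D , l = least-approx D resp p n
        in c l u∈D)
    , (λ { _ (m , _ , _ , q , r) → least-minimal D resp m q r })
    where
    resp : D Respects _≗_
    -- Every cylinder around `y` contains `x`, so an open complement containing `y` would contain
    -- `x` too.
    resp {x} {y} x≗y x∈D = decidable-stable em λ y∉D →
      proj₂ (open∁ y y∉D) (λ i _ → sym (x≗y i)) x∈D

-- Tokens of flag A

continuous-resp : (A : CoherenceSpace a) (f : FlagToken A) {v w : 2^ω} → v ≗ w →
                  CoherenceSpace._≈_ A (proj₁ f v) (proj₁ f w)
continuous-resp A (f , cont) {v} {w} v≗w =
  proj₂ (cont (f w) w (CoherenceSpace.refl A)) (λ i _ → sym (v≗w i))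

Cylinder-⊔ : ∀ {w w′} m n → w′ ∈ Cylinder w (m ⊔ n) → w′ ∈ Cylinder w m × w′ ∈ Cylinder w n
Cylinder-⊔ m n c = (λ i l → c i (m<n⇒m<n⊔o n l)) , (λ i l → c i (m<n⇒m<o⊔n m l))

-- Reduces coherence of `f` and `g` to a check at their first disagreement, which exists by
-- `closed⇒least` unless they agree everywhere.
flag-∼-intro : ExcludedMiddle a → (A : CoherenceSpace a) (f g : FlagToken A) →
               let open CoherenceSpace A in
               (∀ v → (∀ w → w < v → proj₁ f w ≈ proj₁ g w) →
                 ¬ proj₁ f v ≈ proj₁ g v → proj₁ f v ∼ proj₁ g v) →
               CoherenceSpace._∼_ (flag A) f g
flag-∼-intro em A (f , f-cont) (g , g-cont) coh
  with em {∃[ w ] ¬ CoherenceSpace._≈_ A (f w) (g w)}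
... | no ¬d = inj₁ λ w → decidable-stable em λ n → ¬d (w , n)
... | yes d =
  let v , v≉ , below = closed⇒least (λ w → ¬ f w ≈ g w) agreement-open d
      below≈         = λ w l → decidable-stable em (below w l)
  in inj₂ (v , (coh v below≈ v≉ , v≉) , below≈)
  where
  open CoherenceSpace A using (_≈_) renaming (refl to ≈-refl; sym to ≈-sym; trans to ≈-trans)
  open LeastWord em
  agreement-open : Open (∁ (λ w → ¬ f w ≈ g w))
  agreement-open w ¬¬p =
    let p      = decidable-stable em ¬¬p
        -- Both continuity statements are taken at the same value `g w`, so on the smaller cylinder
        -- `f` and `g` share that value.
        m , cf = f-cont (g w) w p
        n , cg = g-cont (g w) w ≈-refl
    in m ⊔ n , λ c k → let c₁ , c₂ = Cylinder-⊔ m n c in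
         k (≈-trans (cf c₁) (≈-sym (cg c₂)))

-- Traces of linear morphisms

module Trace {A B : CoherenceSpace a} (ℓ : LinearMorphism A B) where
  private
    module A = CoherenceSpace A
    module B = CoherenceSpace B
    module ℓ = LinearMorphism ℓ

  trace-respˡ : ∀ {α α′ β} → α A.≈ α′ → trace ℓ α β → trace ℓ α′ β
  trace-respˡ {α} {α′} p =
    ℓ.monotone {singleton A α} {singleton A α′} (A.trans (A.sym p))

  trace-respʳ : ∀ {α β β′} → β B.≈ β′ → trace ℓ α β → trace ℓ α β′
  trace-respʳ {α} = Clique.resp (fun ℓ (singleton A α))

  singleton-compatible : ∀ {α α′} → α A.∼ α′ → Compatible (singleton A α) (singleton A α′)
  singleton-compatible c (inj₁ p) (inj₁ q) = proj₁ A.∼-resp-≈ q (proj₂ A.∼-resp-≈ p A.∼-refl)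
  singleton-compatible c (inj₁ p) (inj₂ q) = proj₁ A.∼-resp-≈ q (proj₂ A.∼-resp-≈ p c)
  singleton-compatible c (inj₂ p) (inj₁ q) = proj₁ A.∼-resp-≈ q (proj₂ A.∼-resp-≈ p (A.∼-sym c))
  singleton-compatible c (inj₂ p) (inj₂ q) = proj₁ A.∼-resp-≈ q (proj₂ A.∼-resp-≈ p A.∼-refl)

  -- Monotonicity places both successors in the image of the two-token clique `pair`.
  trace-∼ : ∀ {α α′ β β′} → α A.∼ α′ → trace ℓ α β → trace ℓ α′ β′ → β B.∼ β′
  trace-∼ {α} {α′} c p q =
    Clique.coherent (fun ℓ pair)
      (ℓ.monotone {singleton A α} {pair} inj₁ p)
      (ℓ.monotone {singleton A α′} {pair} inj₂ q)
    where
    pair : Clique A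
    pair = record
      { tokens   = tokens (singleton A α) ∪ tokens (singleton A α′)
      ; resp     = λ { e (inj₁ r) → inj₁ (A.trans r e)
                     ; e (inj₂ r) → inj₂ (A.trans r e) }
      ; coherent = singleton-compatible c
      }

  -- An empty clique is contained in the union of the empty family, whose image is again an empty
  -- union.
  empty-image : ∀ x → (∀ {α} → α ∉ tokens x) → ∀ {β} → β ∉ tokens (fun ℓ x)
  empty-image x x-empty {β} p
    with () , _ ← proj₁ (ℓ.⨆-comm {I = ⊥} ⊥-elim (λ ()))
                    (ℓ.monotone {x} {⨆ ⊥-elim (λ ())} (λ q → contradiction q x-empty) p)

  trace-injective : ExcludedMiddle a → ∀ {α α′ β} → α A.∼ α′ →
                    trace ℓ α β → trace ℓ α′ β → α A.≈ α′
  trace-injective em {α} {α′} c p q = decidable-stable em λ α≉α′ →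
    empty-image (singleton A α ⊓ singleton A α′)
      (λ (r , s) → α≉α′ (A.trans r (A.sym s)))
      (proj₂ (ℓ.⊓-comm (singleton A α) (singleton A α′) (singleton-compatible c)) (p , q))

  -- A clique is the union of the singletons of its tokens, and `ℓ` commutes with this union.
  image⇒trace : ∀ x {β} → β ∈ tokens (fun ℓ x) → ∃[ α ] (α ∈ tokens x × trace ℓ α β)
  image⇒trace x {β} p =
    let (α , α∈x) , q = proj₁ (ℓ.⨆-comm family compatible)
                          (ℓ.monotone {x} {⨆ family compatible} (λ {α} r → (α , r) , A.refl) p)
    in α , α∈x , q
    where
    family : ∃ (tokens x) → Clique A
    family (α , _) = singleton A α
    compatible : ∀ i j → Compatible (family i) (family j)
    compatible (_ , p) (_ , q) = singleton-compatible (Clique.coherent x p q)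

  trace⇒image : ∀ x {α β} → α ∈ tokens x → trace ℓ α β → β ∈ tokens (fun ℓ x)
  trace⇒image x {α} α∈x = ℓ.monotone {singleton A α} {x} (λ r → Clique.resp x r α∈x)

-- The action of flag on morphisms

module Flag (em : ExcludedMiddle a) where

  module _ {A B : CoherenceSpace a} (ℓ : LinearMorphism A B) where
    open Trace ℓ
    private
      module A = CoherenceSpace A
      module B = CoherenceSpace B
      module FA = CoherenceSpace (flag A)
      module FB = CoherenceSpace (flag B)

    flagRel-∼ : ∀ {f f′ g g′} → f FA.∼ f′ →
                flagRel A B (trace ℓ) f g → flagRel A B (trace ℓ) f′ g′ → g FB.∼ g′
    flagRel-∼ {f} {f′} {g} {g′} (inj₁ f≈f′) p q =
      flag-∼-intro em B g g′ λ v _ _ →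
        trace-∼ A.∼-refl (p v) (trace-respˡ (A.sym (f≈f′ v)) (q v))
    flagRel-∼ {f} {f′} {g} {g′} (inj₂ (w , (c , f≉f′) , below)) p q =
      flag-∼-intro em B g g′ λ v g-below _ → trace-∼ (f∼f′ v g-below) (p v) (q v)
      where
      gw≉g′w : ¬ proj₁ g w B.≈ proj₁ g′ w
      gw≉g′w e = f≉f′ (trace-injective em c (trace-respʳ e (p w)) (q w))

      f∼f′ : ∀ v → (∀ u → u < v → proj₁ g u B.≈ proj₁ g′ u) → proj₁ f v A.∼ proj₁ f′ v
      f∼f′ v g-below with em {proj₁ f v A.≈ proj₁ f′ v}
      ... | yes e = proj₁ A.∼-resp-≈ e A.∼-refl
      ... | no ne = proj₁ A.∼-resp-≈ (continuous-resp A f′ w≗v)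
                      (proj₂ A.∼-resp-≈ (continuous-resp A f w≗v) c)
        where
        w≗v : w ≗ v
        -- `w` is not below `v`, since `g` and `g′` agree below `v` but differ at `w`. `v` is not
        -- below `w`, since `f` and `f′` agree below `w` but differ at `v`.
        w≗v = <-connex (gw≉g′w ∘ g-below w) (ne ∘ below v)

    flagRel-injective : ∀ {f f′ g} → f FA.∼ f′ →
                        flagRel A B (trace ℓ) f g → flagRel A B (trace ℓ) f′ g → f FA.≈ f′
    flagRel-injective (inj₁ f≈f′) p q = f≈f′
    flagRel-injective (inj₂ (w , (c , f≉f′) , _)) p q =
      contradiction (trace-injective em c (p w) (q w)) f≉f′

    flag₁ : LinearMorphism (flag A) (flag B)
    flag₁ = record
      { fun      = λ x → record
        { tokens   = λ g → ∃[ f ] (f ∈ tokens x × flagRel A B (trace ℓ) f g)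
        ; resp     = λ { e (f , f∈x , p) → f , f∈x , λ w → trace-respʳ (e w) (p w) }
        ; coherent = λ { {g} {g′} (f , f∈x , p) (f′ , f′∈x , q) →
                         flagRel-∼ {f} {f′} {g} {g′} (Clique.coherent x f∈x f′∈x) p q }
        }
      ; monotone = λ { x⊑y (f , f∈x , p) → f , x⊑y f∈x , p }
      ; ⨆-comm   = λ x c →
          (λ { (f , (i , f∈x) , p) → i , f , f∈x , p })
        , (λ { (i , f , f∈x , p) → f , (i , f∈x) , p })
      ; ⊓-comm   = λ x y c →
          (λ { (f , (f∈x , f∈y) , p) → (f , f∈x , p) , (f , f∈y , p) })
        -- `f` and `f′` are coherent by compatibility and both related to `g`, hence equal; so `f`
        -- lies in both cliques.
        , (λ { {g} ((f , f∈x , p) , (f′ , f′∈y , q)) →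
               f , (f∈x , Clique.resp y
                     (FA.sym {f} {f′} (flagRel-injective {f} {f′} {g} (c (inj₁ f∈x) (inj₂ f′∈y)) p q))
                     f′∈y) , p })
      }

    trace-flag₁ : ∀ f g → trace flag₁ f g ⇔ flagRel A B (trace ℓ) f g
    trace-flag₁ f g = mk⇔
      (λ { (f′ , f≈f′ , p) w → trace-respˡ (A.sym (f≈f′ w)) (p w) })
      (λ p → f , FA.refl {f} , p)

  flagRel-∘ : {A B C : CoherenceSpace a} (G : LinearMorphism B C) (F : LinearMorphism A B) →
              ∀ f g → flagRel A C (trace (G ∘ᴸ F)) f g →
              ∃[ h ] (flagRel A B (trace F) f h × flagRel B C (trace G) h g)
  flagRel-∘ {A} {B} {C} G F (f , f-cont) (g , g-cont) p =
    (h , h-cont) , F-rel , G-rel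
    where
    module A = CoherenceSpace A
    module B = CoherenceSpace B
    module C = CoherenceSpace C
    module TF = Trace F
    module TG = Trace G

    middle : ∀ w → ∃[ β ] (trace F (f w) β × trace G β (g w))
    middle w = TG.image⇒trace (fun F (singleton A (f w))) (p w)

    h : 2^ω → B.Token
    h = proj₁ ∘ middle

    F-rel : ∀ w → trace F (f w) (h w)
    F-rel = proj₁ ∘ proj₂ ∘ middle

    G-rel : ∀ w → trace G (h w) (g w)
    G-rel = proj₂ ∘ proj₂ ∘ middle

    h-cont : Continuous B h
    h-cont β w hw≈β =
      -- On a cylinder where `f` and `g` are both constant, `h w′` and `h w` are successors of equal
      -- tokens, hence coherent. Both have the successor `g w`, so injectivity of `G` identifies
      -- them.
      let m , cf = f-cont (f w) w A.refl
          n , cg = g-cont (g w) w C.refl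
      in m ⊔ n , λ {w′} c → let c₁ , c₂ = Cylinder-⊔ m n c in
           B.trans
             (TG.trace-injective em
               (TF.trace-∼ (proj₂ A.∼-resp-≈ (A.sym (cf c₁)) A.∼-refl) (F-rel w′) (F-rel w))
               (TG.trace-respʳ (cg c₂) (G-rel w′))
               (G-rel w))
             hw≈β

  flag-isFunctor : IsFunctor (Coh a) (Coh a) flag flag₁
  flag-isFunctor = record
    { F-resp-≈ = λ {A} F≋G x →
        (λ { (f , f∈x , p) → f , f∈x , λ w → proj₁ (F≋G (singleton A (proj₁ f w))) (p w) })
      , (λ { (f , f∈x , p) → f , f∈x , λ w → proj₂ (F≋G (singleton A (proj₁ f w))) (p w) })
    ; F-id     = λ {A} x →
        -- The identity has trace `≈`, so `p` is pointwise equality, which is equality of tokens of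
        -- `flag A`.
        (λ { (f , f∈x , p) → Clique.resp x p f∈x })
      , (λ { {g} g∈x → g , g∈x , λ _ → CoherenceSpace.refl A })
    ; F-∘      = λ {A} G F x →
        (λ { {g} (f , f∈x , p) →
             let h , q , r = flagRel-∘ G F f g p in h , (f , f∈x , q) , r })
      , (λ { (h , (f , f∈x , q) , r) → f , f∈x , λ w →
             Trace.trace⇒image G (fun F (singleton A (proj₁ f w))) (q w) (r w) })
    }

proposition19 : ∀ {a : Level} → ExcludedMiddle a → Σ[ flag₁ ∈ (∀ {A B : CoherenceSpace a} → LinearMorphism A B → LinearMorphism (flag A) (flag B)) ]
    ((∀ {A B : CoherenceSpace a} (ℓ : LinearMorphism A B) (f : CoherenceSpace.Token (flag A)) (g : CoherenceSpace.Token (flag B)) →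
    trace (flag₁ ℓ) f g ⇔ flagRel A B (trace ℓ) f g)
    × IsFunctor (Coh a) (Coh a) flag flag₁)
proposition19 em = flag₁ , trace-flag₁ , flag-isFunctor
  where open Flag em
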